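{- Let $G$ and $H$ be nontrivial, connected graphs both of which have girth at least $4$. The Cartesian product $G\,\Box\, H$ is well-dominated if and only if $G = H = K_2$ (up to isomorphism).
   Context: All graphs are finite and simple. A graph is nontrivial if it has at least $2$ vertices. The girth of a graph is the length of its shortest cycle; "girth at least $4$" means triangle-free (acyclic graphs, having infinite girth, are included). A set $D\subseteq V(G)$ is a dominating set of $G$ if every vertex of $G$ is in $D$ or adjacent to a vertex of $D$. A graph is well-dominated if all of its minimal (with respect to inclusion) dominating sets have the same cardinality. The Cartesian product $G\,\Box\, H$ has vertex set $V(G)\times V(H)$, and $(g_1,h_1)$, $(g_2,h_2)$ are adjacent iff ($g_1=g_2$ and $h_1h_2\in E(H)$) or ($h_1=h_2$ and $g_1g_2\in E(G)$). $K_n$ is the complete graph on $n$ vertices. -}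

module Defs where

open import Data.Fin.Base using (Fin; zero; suc; inject₁; fromℕ; remQuot)
open import Data.Fin.Properties using (_≟_)
open import Data.Fin.Subset using (Subset; _∈_; _⊂_; ∣_∣)
open import Data.Nat.Base using (ℕ; _+_; _*_; _≤_)
open import Data.Product.Base using (_×_; _,_; ∃-syntax)
open import Data.Sum.Base as Sum using (_⊎_; inj₁; inj₂)
open import Function.Base using (_on_)
open import Function.Bundles using (_↔_; _⇔_; Inverse)
open import Function.Definitions using (Injective)
open import Level using (0ℓ)
open import Relation.Binary.Construct.Closure.ReflexiveTransitive using (Star)
open import Relation.Binary.Core using (Rel)
open import Relation.Binary.Definitions
  using (Decidable; Irreflexive; Symmetric)
open import Relation.Binary.PropositionalEquality.Core
  using (_≡_; _≢_; refl; sym; ≢-sym)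
open import Relation.Nullary.Decidable.Core using (¬?; _×-dec_; _⊎-dec_)
open import Relation.Nullary.Negation.Core using (¬_)

-- Adjacency is only ever used as a proposition (it is compared by _⇔_),
-- so distinct proofs of Adj u v do not represent parallel edges.

record Graph : Set₁ where
  field
    order       : ℕ
    Adj         : Rel (Fin order) 0ℓ
    adj?        : Decidable Adj
    adj-sym     : Symmetric Adj
    adj-irrefl  : Irreflexive _≡_ Adj

  Vertex : Set
  Vertex = Fin order

open Graph

infix 4 _≅_

record _≅_ (G H : Graph) : Set where
  field
    vertices : Vertex G ↔ Vertex H
    edges    : ∀ u v →
               Adj G u v ⇔ Adj H (Inverse.to vertices u) (Inverse.to vertices v)

Nontrivial : Graph → Set
Nontrivial G = 2 ≤ order G

Connected : Graph → Set
Connected G = ∀ u v → Star (Adj G) u v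

-- A cycle of length 3 + k: distinct vertices v₀, …, v₂₊ₖ with vᵢ adjacent
-- to vᵢ₊₁ and the last vertex adjacent to v₀.

record Cycle (G : Graph) (k : ℕ) : Set where
  field
    vertex   : Fin (3 + k) → Vertex G
    distinct : Injective _≡_ _≡_ vertex
    step     : ∀ i → Adj G (vertex (inject₁ i)) (vertex (suc i))
    close    : Adj G (vertex (fromℕ (2 + k))) (vertex zero)

-- Holds for every g when G is acyclic, i.e. of infinite girth.

GirthAtLeast : ℕ → Graph → Set
GirthAtLeast g G = ∀ k → Cycle G k → g ≤ 3 + k

Dominating : (G : Graph) → Subset (order G) → Set
Dominating G D = ∀ v → v ∈ D ⊎ (∃[ u ] u ∈ D × Adj G v u)

MinimalDominating : (G : Graph) → Subset (order G) → Set
MinimalDominating G D = Dominating G D × (∀ D′ → D′ ⊂ D → ¬ Dominating G D′)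

WellDominated : Graph → Set
WellDominated G = ∀ D D′ → MinimalDominating G D → MinimalDominating G D′ →
                  ∣ D ∣ ≡ ∣ D′ ∣

K : ℕ → Graph
K n = record
  { order      = n
  ; Adj        = _≢_
  ; adj?       = λ u v → ¬? (u ≟ v)
  ; adj-sym    = ≢-sym
  ; adj-irrefl = λ u≡v u≢v → u≢v u≡v
  }

□-Adj : (G H : Graph) → Rel (Vertex G × Vertex H) 0ℓ
□-Adj G H (g₁ , h₁) (g₂ , h₂) =
  (g₁ ≡ g₂ × Adj H h₁ h₂) ⊎ (h₁ ≡ h₂ × Adj G g₁ g₂)

-- Pairs of vertices are numbered through the bijection
-- remQuot : Fin (m * n) → Fin m × Fin n, whose inverse is combine.

infixr 7 _□_

_□_ : Graph → Graph → Graph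
G □ H = record
  { order      = order G * order H
  ; Adj        = □-Adj G H on remQuot (order H)
  ; adj?       = λ p q → dec (remQuot (order H) p) (remQuot (order H) q)
  ; adj-sym    = Sum.map (λ (e , a) → sym e , adj-sym H a)
                         (λ (e , a) → sym e , adj-sym G a)
  ; adj-irrefl = λ { refl (inj₁ (_ , a)) → adj-irrefl H refl a
                   ; refl (inj₂ (_ , a)) → adj-irrefl G refl a }
  }
  where
  dec : Decidable (□-Adj G H)
  dec (g₁ , h₁) (g₂ , h₂) =
    ((g₁ ≟ g₂) ×-dec adj? H h₁ h₂) ⊎-dec ((h₁ ≟ h₂) ×-dec adj? G g₁ g₂)

{-# OPTIONS --safe #-}

-- In a well-dominated graph a minimal dominating set is never larger than
-- any dominating set.
--
-- If G and H have leaves ℓ and m with supports s and t, some minimal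
-- dominating set of G □ H contains the whole (independent) neighbourhood of
-- (s , t); in it (ℓ , t) and (s , m) can be traded for (ℓ , m), unless they
-- are the only neighbours of (s , t), that is, unless G = H = K₂.
--
-- Otherwise one factor, say H, has no leaves.  Let X be a dominating set of G
-- all of whose vertices have external private neighbours.  Then X × V(H) is
-- minimal.  For x ∈ X, removing {x} × N[h] and adding the external private
-- neighbours of x in layer h keeps it dominating, so x has at least
-- deg h + 1 of them and |X| (deg h + 2) ≤ |V(G)|.  Let D be such a set in H;
-- summing over D gives |X| (|V(H)| + |D|) ≤ |D| |V(G)|, while
-- |D| |V(G)| = |X| |V(H)| because V(G) × D is minimal too.

module Submission where

open import Defs
open import Data.Bool.Base using (if_then_else_)
open import Data.Empty using (⊥; ⊥-elim)
open import Data.Fin.Base using (Fin; zero; suc; remQuot; combine; fromℕ<; _↑ˡ_; _↑ʳ_)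
open import Data.Fin.Permutation using (↔⇒≡)
open import Data.Fin.Properties
  using (_≟_; any?; all?; suc-injective; remQuot-combine; combine-remQuot)
open import Data.Fin.Subset
  using (Subset; inside; outside; _∈_; _∉_; _⊆_; _⊂_; _∪_; _-_; ⁅_⁆; ⊤; ∣_∣)
open import Data.Fin.Subset.Induction using (⊂-wellFounded)
open import Data.Fin.Subset.Properties
open import Data.Nat.Base using (ℕ; zero; suc; _+_; _*_; _≤_; _<_; z≤n; s≤s; >-nonZero)
open import Data.Nat.Induction using (<-wellFounded)
open import Data.Nat.Properties hiding (suc-injective) renaming (_≟_ to _≟ℕ_)
open import Data.Product.Base using (_×_; _,_; proj₁; proj₂; ∃; ∃-syntax; uncurry; swap)
open import Data.Sum.Base as Sum using (_⊎_; inj₁; inj₂)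
open import Data.Vec.Base using (tabulate; []; _∷_)
open import Data.Vec.Properties using (lookup⇒[]=; []=⇒lookup; lookup∘tabulate)
open import Function.Base using (_∘_; id)
open import Function.Bundles using (_⇔_; mk⇔; mk↔ₛ′; Equivalence; Injection)
open import Function.Properties.Inverse using (↔⇒↣)
open import Induction.WellFounded using (Acc; acc)
open import Level using (0ℓ)
open import Relation.Binary.Construct.Closure.Reflexive using (ReflClosure; refl; [_])
open import Relation.Binary.Construct.Closure.ReflexiveTransitive using (Star; ε; _◅_)
open import Relation.Binary.Core using (Rel)
open import Relation.Binary.PropositionalEquality
  using (_≡_; _≢_; refl; sym; trans; cong; subst; subst₂)
open import Relation.Nullary.Decidable
  using (Dec; yes; no; does; dec-true; dec-false; decidable-stable; from-no;
         ¬?; _×-dec_; _⊎-dec_; _→-dec_)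
open import Relation.Nullary.Negation using (¬_; contradiction)
open import Relation.Unary using (Pred; Decidable)

open Graph

open import Algebra.Properties.CommutativeSemigroup *-commutativeSemigroup using (x∙yz≈y∙xz)
open import Algebra.Properties.Semiring.Sum +-*-semiring

private variable
  A B C : Set
  m n : ℕ

-- Indicators of decidable propositions and finite sums of them.

⟦_⟧ : Dec A → ℕ
⟦ A? ⟧ = if does A? then 1 else 0

⟦⟧-mono : (A? : Dec A) (B? : Dec B) → (A → B) → ⟦ A? ⟧ ≤ ⟦ B? ⟧
⟦⟧-mono (no _)  _       f = z≤n
⟦⟧-mono (yes _) (yes _) f = ≤-refl
⟦⟧-mono (yes a) (no ¬b) f = contradiction (f a) ¬b

⟦⟧-true : (A? : Dec A) → A → ⟦ A? ⟧ ≡ 1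
⟦⟧-true (yes _) a = refl
⟦⟧-true (no ¬a) a = contradiction a ¬a

⟦⟧-false : (A? : Dec A) → ¬ A → ⟦ A? ⟧ ≡ 0
⟦⟧-false (yes a) ¬a = contradiction a ¬a
⟦⟧-false (no _)  ¬a = refl

⟦⟧-disjoint : (A? : Dec A) (B? : Dec B) (C? : Dec C) →
              (A → C) → (B → C) → (A → ¬ B) → ⟦ A? ⟧ + ⟦ B? ⟧ ≤ ⟦ C? ⟧
⟦⟧-disjoint (no _)  B?      C? f g d = ⟦⟧-mono B? C? g
⟦⟧-disjoint (yes a) (no _)  C? f g d = ⟦⟧-mono (yes a) C? f
⟦⟧-disjoint (yes a) (yes b) C? f g d = contradiction b (d a)

⟦⟧-cover : (A? : Dec A) (B? : Dec B) (C? : Dec C) →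
           (C → A ⊎ B) → ⟦ C? ⟧ ≤ ⟦ A? ⟧ + ⟦ B? ⟧
⟦⟧-cover A?      B? (no _)  f = z≤n
⟦⟧-cover A?      B? (yes c) f with f c
... | inj₁ a = ≤-trans (≤-reflexive (sym (⟦⟧-true A? a))) (m≤m+n ⟦ A? ⟧ ⟦ B? ⟧)
... | inj₂ b = ≤-trans (≤-reflexive (sym (⟦⟧-true B? b))) (m≤n+m ⟦ B? ⟧ ⟦ A? ⟧)

∑-mono : {f g : Fin n → ℕ} → (∀ i → f i ≤ g i) → sum f ≤ sum g
∑-mono {zero}  f≤g = z≤n
∑-mono {suc n} f≤g = +-mono-≤ (f≤g zero) (∑-mono (f≤g ∘ suc))

∑-const : ∀ n c → ∑[ i < n ] c ≡ n * c
∑-const zero    c = refl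
∑-const (suc n) c = cong (c +_) (∑-const n c)

term≤∑ : (f : Fin n → ℕ) → ∀ i → f i ≤ sum f
term≤∑ f zero    = m≤m+n (f zero) _
term≤∑ f (suc i) = ≤-trans (term≤∑ (f ∘ suc) i) (m≤n+m _ (f zero))

∑-combine : ∀ m n (f : Fin (m * n) → ℕ) →
            sum f ≡ ∑[ i < m ] ∑[ j < n ] f (combine i j)
∑-combine zero    n f = refl
∑-combine (suc m) n f =
  trans (∑-++ n f) (cong (sum (f ∘ (_↑ˡ m * n)) +_) (∑-combine m n (f ∘ (n ↑ʳ_))))
  where
  ∑-++ : ∀ k {l} (f : Fin (k + l) → ℕ) →
         sum f ≡ sum (f ∘ (_↑ˡ l)) + sum (f ∘ (k ↑ʳ_))
  ∑-++ zero    f = refl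
  ∑-++ (suc k) f = trans (cong (f zero +_) (∑-++ k (f ∘ suc)))
                         (sym (+-assoc (f zero) _ _))

count : {P : Pred (Fin n) 0ℓ} → Decidable P → ℕ
count P? = sum (⟦_⟧ ∘ P?)

count₂ : {P : Pred (Fin m × Fin n) 0ℓ} → Decidable P → ℕ
count₂ {m} {n} P? = ∑[ i < m ] ∑[ j < n ] ⟦ P? (i , j) ⟧

module _ {P : Pred (Fin n) 0ℓ} (P? : Decidable P) where

  count-≥1 : ∃ P → 1 ≤ count P?
  count-≥1 (i , p) =
    ≤-trans (≤-reflexive (sym (⟦⟧-true (P? i) p))) (term≤∑ (⟦_⟧ ∘ P?) i)

count-empty : {P : Pred (Fin n) 0ℓ} (P? : Decidable P) → (∀ i → ¬ P i) → count P? ≡ 0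
count-empty {n} P? empty =
  trans (sum-cong-≗ λ i → ⟦⟧-false (P? i) (empty i)) (trans (∑-const n 0) (*-zeroʳ n))

count-unique : {P : Pred (Fin n) 0ℓ} (P? : Decidable P) →
               (∀ {i j} → P i → P j → i ≡ j) → count P? ≤ 1
count-unique {zero}  P? unique = z≤n
count-unique {suc n} P? unique with P? zero
... | no  _  = count-unique (P? ∘ suc) (λ p q → suc-injective (unique p q))
... | yes p₀ = s≤s (≤-reflexive (count-empty (P? ∘ suc)
                 λ i p → contradiction (unique p₀ p) λ ()))

count-at : ∀ (i : Fin n) (A? : Dec A) → count (λ j → (j ≟ i) ×-dec A?) ≤ ⟦ A? ⟧
count-at i (yes a) = count-unique (λ j → (j ≟ i) ×-dec yes a)
  λ (j≡i , _) (k≡i , _) → trans j≡i (sym k≡i)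
count-at i (no ¬a) = ≤-reflexive (count-empty (λ j → (j ≟ i) ×-dec no ¬a) λ _ → ¬a ∘ proj₂)

guarded-≥ : {P : Pred (Fin n) 0ℓ} (A? : Dec A) (P? : Decidable P) → ∀ {k} →
            (A → k ≤ count P?) → ⟦ A? ⟧ * k ≤ count (λ i → A? ×-dec P? i)
guarded-≥ (yes a) P? {k} k≤ = ≤-trans (≤-reflexive (*-identityˡ k)) (k≤ a)
guarded-≥ (no _)  P? {k} k≤ = z≤n

guarded-≤ : {P : Pred (Fin n) 0ℓ} (A? : Dec A) (P? : Decidable P) →
            count (λ i → A? ×-dec P? i) ≤ ⟦ A? ⟧ * count P?
guarded-≤ (yes a) P? = ≤-reflexive (sym (*-identityˡ (count P?)))
guarded-≤ (no ¬a) P? = ≤-reflexive (count-empty (λ i → no ¬a ×-dec P? i) λ _ → ¬a ∘ proj₁)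

-- Subsets given by decidable predicates, and their cardinalities.

toSubset : {P : Pred (Fin n) 0ℓ} → Decidable P → Subset n
toSubset P? = tabulate (does ∘ P?)

module _ {P : Pred (Fin n) 0ℓ} (P? : Decidable P) where

  ∈-toSubset⁺ : ∀ {i} → P i → i ∈ toSubset P?
  ∈-toSubset⁺ {i} p = lookup⇒[]= i _
    (trans (lookup∘tabulate _ i) (dec-true (P? i) p))

  ∈-toSubset⁻ : ∀ {i} → i ∈ toSubset P? → P i
  ∈-toSubset⁻ {i} i∈ with P? i | trans (sym (lookup∘tabulate (does ∘ P?) i)) ([]=⇒lookup i∈)
  ... | yes p | _ = p

∣toSubset∣ : {P : Pred (Fin n) 0ℓ} (P? : Decidable P) →
             ∣ toSubset P? ∣ ≡ count P?
∣toSubset∣ {zero}  P? = refl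
∣toSubset∣ {suc n} P? with P? zero
... | yes _ = cong suc (∣toSubset∣ (P? ∘ suc))
... | no _  = ∣toSubset∣ (P? ∘ suc)

∣∣≡count : (D : Subset n) → ∣ D ∣ ≡ count (_∈? D)
∣∣≡count []            = refl
∣∣≡count (inside  ∷ D) = cong suc (∣∣≡count D)
∣∣≡count (outside ∷ D) = ∣∣≡count D

∣p∪q∣≤∣p∣+∣q∣ : (p q : Subset n) → ∣ p ∪ q ∣ ≤ ∣ p ∣ + ∣ q ∣
∣p∪q∣≤∣p∣+∣q∣ []            []            = z≤n
∣p∪q∣≤∣p∣+∣q∣ (outside ∷ p) (outside ∷ q) = ∣p∪q∣≤∣p∣+∣q∣ p q
∣p∪q∣≤∣p∣+∣q∣ (outside ∷ p) (inside  ∷ q) =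
  ≤-trans (s≤s (∣p∪q∣≤∣p∣+∣q∣ p q)) (≤-reflexive (sym (+-suc ∣ p ∣ ∣ q ∣)))
∣p∪q∣≤∣p∣+∣q∣ (inside  ∷ p) (outside ∷ q) = s≤s (∣p∪q∣≤∣p∣+∣q∣ p q)
∣p∪q∣≤∣p∣+∣q∣ (inside  ∷ p) (inside  ∷ q) =
  s≤s (≤-trans (∣p∪q∣≤∣p∣+∣q∣ p q) (+-monoʳ-≤ ∣ p ∣ (n≤1+n ∣ q ∣)))

-- Minimal dominating sets of a single graph.

module _ (Γ : Graph) where

  dominating? : Decidable (Dominating Γ)
  dominating? D = all? λ v → (v ∈? D) ⊎-dec any? λ u → (u ∈? D) ×-dec adj? Γ v u

  dominating-⊆ : ∀ {D E} → D ⊆ E → Dominating Γ D → Dominating Γ E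
  dominating-⊆ D⊆E dom v =
    Sum.map D⊆E (λ (u , u∈D , v~u) → u , D⊆E u∈D , v~u) (dom v)

  minimal-within : ∀ D → Dominating Γ D → ∃[ M ] M ⊆ D × MinimalDominating Γ M
  minimal-within D = go D (⊂-wellFounded D)
    where
    go : ∀ D → Acc _⊂_ D → Dominating Γ D →
         ∃[ M ] M ⊆ D × MinimalDominating Γ M
    go D (acc rec) dom with any? (λ x → (x ∈? D) ×-dec dominating? (D - x))
    ... | yes (x , x∈D , dom′) =
      let M , M⊆D-x , min = go (D - x) (rec (x∈p⇒p-x⊂p x∈D)) dom′
      in  M , p─q⊆p D ⁅ x ⁆ ∘ M⊆D-x , min
    -- Supersets of dominating sets dominate, so testing the one-vertex deletions `D - x` rules out
    -- every proper subset of `D`.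
    ... | no needed = D , id , dom , λ D′ (D′⊆D , x , x∈D , x∉D′) dom′ →
      needed (x , x∈D , dominating-⊆
        (λ y∈D′ → x∈p∧x≢y⇒x∈p-y (D′⊆D y∈D′) λ { refl → x∉D′ y∈D′ }) dom′)

  minimal-≤ : WellDominated Γ → ∀ {D E} →
              MinimalDominating Γ D → Dominating Γ E → ∣ D ∣ ≤ ∣ E ∣
  minimal-≤ wd {D} {E} min dom =
    let M , M⊆E , min′ = minimal-within E dom
    in  ≤-trans (≤-reflexive (wd D M min min′)) (p⊆q⇒∣p∣≤∣q∣ M⊆E)

module _ {V : Set} (_~_ : Rel V 0ℓ) where

  -- Stated for an arbitrary relation, so that it applies to `□-Adj` on pairs as well as to `Adj` on
  -- numbered vertices; `ReflClosure` turns open neighbourhoods into closed ones.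
  Dominates : Pred V 0ℓ → Set
  Dominates P = ∀ v → ∃[ u ] P u × ReflClosure _~_ v u

  -- The witness `v` is a private neighbour of `u`, possibly `u` itself.
  Irredundant : Pred V 0ℓ → Set
  Irredundant P = ∀ {u} → P u → ∃[ v ] ReflClosure _~_ v u ×
                  (∀ {w} → P w → ReflClosure _~_ v w → w ≡ u)

module _ (Γ : Graph) where

  dominates⇒dominating : {P : Pred (Vertex Γ) 0ℓ} (P? : Decidable P) →
    Dominates (Adj Γ) P → Dominating Γ (toSubset P?)
  dominates⇒dominating P? dom v with dom v
  ... | u , p , refl    = inj₁ (∈-toSubset⁺ P? p)
  ... | u , p , [ v~u ] = inj₂ (u , ∈-toSubset⁺ P? p , v~u)

  -- A proper subset misses some `x`, and then nothing is left to dominate the private neighbour of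
  -- `x`.
  irredundant⇒minimal : {P : Pred (Vertex Γ) 0ℓ} (P? : Decidable P) →
    Dominates (Adj Γ) P → Irredundant (Adj Γ) P → MinimalDominating Γ (toSubset P?)
  irredundant⇒minimal P? dom irr = dominates⇒dominating P? dom , minimal
    where
    minimal : ∀ D′ → D′ ⊂ toSubset P? → ¬ Dominating Γ D′
    minimal D′ (D′⊆D , x , x∈D , x∉D′) dom′ with irr (∈-toSubset⁻ P? x∈D)
    ... | v , _ , private′ with dom′ v
    ...   | inj₁ v∈D′ =
      x∉D′ (subst (_∈ D′) (private′ (∈-toSubset⁻ P? (D′⊆D v∈D′)) refl) v∈D′)
    ...   | inj₂ (u , u∈D′ , v~u) =
      x∉D′ (subst (_∈ D′) (private′ (∈-toSubset⁻ P? (D′⊆D u∈D′)) [ v~u ]) u∈D′)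

-- Trading two neighbours of a vertex for one vertex.

module _ (Γ : Graph) where

  -- A minimal dominating set avoiding all neighbours of the independent set
  -- N(c) contains N(c); trading a and b for z makes it smaller.
  neighbourhood-trade : WellDominated Γ → ∀ {c a b z} →
    Adj Γ c a → Adj Γ c b → a ≢ b →
    (∀ {u v} → Adj Γ c u → Adj Γ c v → ¬ Adj Γ u v) →
    (∀ {v} → ReflClosure (Adj Γ) v a ⊎ ReflClosure (Adj Γ) v b →
      ReflClosure (Adj Γ) v z ⊎
      ∃[ j ] Adj Γ c j × j ≢ a × j ≢ b × ReflClosure (Adj Γ) v j) →
    ⊥
  neighbourhood-trade wd {c} {a} {b} {z} c~a c~b a≢b independent covered =
    <⇒≱ smaller (minimal-≤ Γ wd minimal dom′)
    where
    free? = λ v → ¬? (any? λ u → adj? Γ c u ×-dec adj? Γ v u)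

    free-dominates : Dominating Γ (toSubset free?)
    free-dominates v with any? (λ u → adj? Γ c u ×-dec adj? Γ v u)
    ... | no none = inj₁ (∈-toSubset⁺ free? none)
    -- Independence of N(c) puts `u` itself among the free vertices, so it may dominate `v`.
    ... | yes (u , c~u , v~u) =
      inj₂ (u , ∈-toSubset⁺ free? (λ (w , c~w , u~w) → independent c~u c~w u~w) , v~u)

    within = minimal-within Γ (toSubset free?) free-dominates
    D = proj₁ within
    D-free = proj₁ (proj₂ within)
    minimal = proj₂ (proj₂ within)

    -- No neighbour of a vertex of N(c) is free, so a vertex of N(c) can only be dominated by
    -- itself.
    N⊆D : ∀ {u} → Adj Γ c u → u ∈ D
    N⊆D {u} c~u with proj₁ minimal u
    ... | inj₁ u∈D = u∈D
    ... | inj₂ (w , w∈D , u~w) =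
      ⊥-elim (∈-toSubset⁻ free? (D-free w∈D) (u , c~u , adj-sym Γ u~w))

    D′ = (D - a - b) ∪ ⁅ z ⁆

    keep : ∀ {u} → u ∈ D → u ≢ a → u ≢ b → u ∈ D′
    keep u∈D u≢a u≢b = p⊆p∪q ⁅ z ⁆ (x∈p∧x≢y⇒x∈p-y (x∈p∧x≢y⇒x∈p-y u∈D u≢a) u≢b)

    dominated : ∀ {v u} → ReflClosure (Adj Γ) v u → u ∈ D′ →
                v ∈ D′ ⊎ ∃[ u ] u ∈ D′ × Adj Γ v u
    dominated refl    u∈D′ = inj₁ u∈D′
    dominated [ v~u ] u∈D′ = inj₂ (_ , u∈D′ , v~u)

    rescued : ∀ {v} → ReflClosure (Adj Γ) v a ⊎ ReflClosure (Adj Γ) v b →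
              v ∈ D′ ⊎ ∃[ u ] u ∈ D′ × Adj Γ v u
    rescued near with covered near
    ... | inj₁ v≃z = dominated v≃z (q⊆p∪q (D - a - b) ⁅ z ⁆ (x∈⁅x⁆ z))
    ... | inj₂ (j , c~j , j≢a , j≢b , v≃j) = dominated v≃j (keep (N⊆D c~j) j≢a j≢b)

    closed : ∀ {v u} → u ∈ D → ReflClosure (Adj Γ) v u →
             v ∈ D′ ⊎ ∃[ u ] u ∈ D′ × Adj Γ v u
    closed {v} {u} u∈D v≃u with u ≟ a | u ≟ b
    ... | yes refl | _        = rescued (inj₁ v≃u)
    ... | no _     | yes refl = rescued (inj₂ v≃u)
    ... | no u≢a   | no u≢b   = dominated v≃u (keep u∈D u≢a u≢b)

    dom′ : Dominating Γ D′
    dom′ v with proj₁ minimal v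
    ... | inj₁ v∈D             = closed v∈D refl
    ... | inj₂ (u , u∈D , v~u) = closed u∈D [ v~u ]

    smaller : ∣ D′ ∣ < ∣ D ∣
    smaller = begin-strict
      ∣ D′ ∣                    ≤⟨ ∣p∪q∣≤∣p∣+∣q∣ (D - a - b) ⁅ z ⁆ ⟩
      ∣ D - a - b ∣ + ∣ ⁅ z ⁆ ∣ ≡⟨ cong (∣ D - a - b ∣ +_) (∣⁅x⁆∣≡1 z) ⟩
      ∣ D - a - b ∣ + 1         ≡⟨ +-comm ∣ D - a - b ∣ 1 ⟩
      -- `a ≢ b` keeps `b` in `D - a`, so the second deletion lowers the size again.
      suc ∣ D - a - b ∣         ≤⟨ x∈p⇒∣p-x∣<∣p∣ (x∈p∧x≢y⇒x∈p-y (N⊆D c~b) (a≢b ∘ sym)) ⟩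
      ∣ D - a ∣                 <⟨ x∈p⇒∣p-x∣<∣p∣ (N⊆D c~a) ⟩
      ∣ D ∣                     ∎
      where open ≤-Reasoning

-- Well-dominated products in terms of pairs of vertices.

-- This is `minimal-≤` for G □ H without the numbering of pairs: sizes become double sums, to which
-- exchange of summation applies.
WellDominatedPairs : Graph → Graph → Set₁
WellDominatedPairs G H =
  {P Q : Pred (Vertex G × Vertex H) 0ℓ} (P? : Decidable P) (Q? : Decidable Q) →
  Dominates (□-Adj G H) P → Irredundant (□-Adj G H) P → Dominates (□-Adj G H) Q →
  count₂ P? ≤ count₂ Q?

module _ (G H : Graph) where

  private
    pair : Vertex (G □ H) → Vertex G × Vertex H
    pair = remQuot (order H)

    vertex : Vertex G × Vertex H → Vertex (G □ H)
    vertex = uncurry combine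

    pair∘vertex : ∀ p → pair (vertex p) ≡ p
    pair∘vertex (g , h) = remQuot-combine g h

    vertex∘pair : ∀ v → vertex (pair v) ≡ v
    vertex∘pair = combine-remQuot {order G} (order H)

    vertex-≃ : ∀ {p q} → ReflClosure (□-Adj G H) p q →
               ReflClosure (Adj (G □ H)) (vertex p) (vertex q)
    vertex-≃ refl = refl
    vertex-≃ {p} {q} [ p~q ] =
      [ subst₂ (□-Adj G H) (sym (pair∘vertex p)) (sym (pair∘vertex q)) p~q ]

    pair-≃ : ∀ {u v} → ReflClosure (Adj (G □ H)) u v →
             ReflClosure (□-Adj G H) (pair u) (pair v)
    pair-≃ refl    = refl
    pair-≃ [ u~v ] = [ u~v ]

    count∘pair : {P : Pred (Vertex G × Vertex H) 0ℓ} (P? : Decidable P) →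
                 count (P? ∘ pair) ≡ count₂ P?
    count∘pair P? = trans (∑-combine (order G) (order H) (⟦_⟧ ∘ P? ∘ pair))
      (sum-cong-≗ λ g → sum-cong-≗ λ h → cong (⟦_⟧ ∘ P?) (pair∘vertex (g , h)))

    dominates∘pair : {P : Pred (Vertex G × Vertex H) 0ℓ} →
      Dominates (□-Adj G H) P → Dominates (Adj (G □ H)) (P ∘ pair)
    dominates∘pair {P} dom v with dom (pair v)
    ... | q , Pq , v≃q = vertex q , subst P (sym (pair∘vertex q)) Pq ,
      subst (λ u → ReflClosure _ u (vertex q)) (vertex∘pair v) (vertex-≃ v≃q)

    irredundant∘pair : {P : Pred (Vertex G × Vertex H) 0ℓ} →
      Irredundant (□-Adj G H) P → Irredundant (Adj (G □ H)) (P ∘ pair)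
    irredundant∘pair irr {u} Pu with irr Pu
    ... | q , q≃u , private′ = vertex q ,
      subst (ReflClosure _ (vertex q)) (vertex∘pair u) (vertex-≃ q≃u) ,
      λ {w} Pw q≃w → trans (sym (vertex∘pair w)) (trans
        (cong vertex (private′ Pw
          (subst (λ p → ReflClosure _ p (pair w)) (pair∘vertex q) (pair-≃ q≃w))))
        (vertex∘pair u))

  wellDominatedPairs : WellDominated (G □ H) → WellDominatedPairs G H
  wellDominatedPairs wd P? Q? domP irrP domQ = begin
    count₂ P?                  ≡⟨ count∘pair P? ⟨
    count (P? ∘ pair)          ≡⟨ ∣toSubset∣ (P? ∘ pair) ⟨
    ∣ toSubset (P? ∘ pair) ∣   ≤⟨ minimal-≤ (G □ H) wd
                                    (irredundant⇒minimal (G □ H) (P? ∘ pair)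
                                      (dominates∘pair domP) (irredundant∘pair irrP))
                                    (dominates⇒dominating (G □ H) (Q? ∘ pair)
                                      (dominates∘pair domQ)) ⟩
    ∣ toSubset (Q? ∘ pair) ∣   ≡⟨ ∣toSubset∣ (Q? ∘ pair) ⟩
    count (Q? ∘ pair)          ≡⟨ count∘pair Q? ⟩
    count₂ Q?                  ∎
    where open ≤-Reasoning

  neighbourhood-trade-pairs : WellDominated (G □ H) → ∀ {c a b z} →
    □-Adj G H c a → □-Adj G H c b → a ≢ b →
    (∀ {u v} → □-Adj G H c u → □-Adj G H c v → ¬ □-Adj G H u v) →
    (∀ {v} → ReflClosure (□-Adj G H) v a ⊎ ReflClosure (□-Adj G H) v b →
      ReflClosure (□-Adj G H) v z ⊎
      ∃[ j ] □-Adj G H c j × j ≢ a × j ≢ b × ReflClosure (□-Adj G H) v j) →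
    ⊥
  neighbourhood-trade-pairs wd {c} {a} {b} {z} c~a c~b a≢b independent covered =
    neighbourhood-trade (G □ H) wd {vertex c} {vertex a} {vertex b} {vertex z}
      (adj c~a) (adj c~b) (a≢b ∘ vertex-injective)
      (λ c~u c~v → independent (from-c c~u) (from-c c~v))
      (Sum.map vertex-≃′ (λ (j , c~j , j≢a , j≢b , v≃j) →
          vertex j , adj c~j , j≢a ∘ vertex-injective , j≢b ∘ vertex-injective , vertex-≃′ v≃j)
        ∘ covered ∘ Sum.map pair-≃′ pair-≃′)
    where
    adj : ∀ {p q} → □-Adj G H p q → Adj (G □ H) (vertex p) (vertex q)
    adj {p} {q} = subst₂ (□-Adj G H) (sym (pair∘vertex p)) (sym (pair∘vertex q))

    from-c : ∀ {u} → Adj (G □ H) (vertex c) u → □-Adj G H c (pair u)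
    from-c {u} = subst (λ p → □-Adj G H p (pair u)) (pair∘vertex c)

    vertex-injective : ∀ {p q} → vertex p ≡ vertex q → p ≡ q
    vertex-injective {p} {q} eq =
      trans (sym (pair∘vertex p)) (trans (cong pair eq) (pair∘vertex q))

    vertex-≃′ : ∀ {v q} → ReflClosure (□-Adj G H) (pair v) q →
                ReflClosure (Adj (G □ H)) v (vertex q)
    vertex-≃′ {v} v≃q = subst (λ u → ReflClosure _ u _) (vertex∘pair v) (vertex-≃ v≃q)

    pair-≃′ : ∀ {v q} → ReflClosure (Adj (G □ H)) v (vertex q) →
              ReflClosure (□-Adj G H) (pair v) q
    pair-≃′ {v} {q} v≃q = subst (ReflClosure _ (pair v)) (pair∘vertex q) (pair-≃ v≃q)

-- Swapping coordinates is an isomorphism between the two products, and sizes survive by exchanging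
-- the two sums.
wellDominatedPairs-swap : ∀ G H → WellDominatedPairs G H → WellDominatedPairs H G
wellDominatedPairs-swap G H wd {P} {Q} P? Q? domP irrP domQ =
  subst₂ _≤_ (∑-comm λ g h → ⟦ P? (h , g) ⟧) (∑-comm λ g h → ⟦ Q? (h , g) ⟧)
    (wd (P? ∘ swap) (Q? ∘ swap) (dom-swap {P} domP) irr-swap (dom-swap {Q} domQ))
  where
  ≃-swap : ∀ {G H p q} → ReflClosure (□-Adj G H) p q →
           ReflClosure (□-Adj H G) (swap p) (swap q)
  ≃-swap refl    = refl
  ≃-swap [ p~q ] = [ Sum.swap p~q ]

  dom-swap : ∀ {P} → Dominates (□-Adj H G) P → Dominates (□-Adj G H) (P ∘ swap)
  dom-swap dom p with dom (swap p)
  ... | q , Pq , p≃q = swap q , Pq , ≃-swap {H} {G} p≃q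

  irr-swap : Irredundant (□-Adj G H) (P ∘ swap)
  irr-swap {u} Pu with irrP Pu
  ... | q , q≃u , private′ =
    swap q , ≃-swap {H} {G} q≃u ,
    λ {w} Pw q≃w → cong swap (private′ {swap w} Pw (≃-swap {G} {H} {swap q} {w} q≃w))

-- Dominating sets with external private neighbours.

x∉p-x : (p : Subset n) (x : Fin n) → x ∉ p - x
x∉p-x p x x∈p-x =
  -- Deleting `x` again would shrink `p - x`, although a repeated difference changes nothing.
  <-irrefl (cong ∣_∣ (p─q─q≡p─q p ⁅ x ⁆)) (x∈p⇒∣p-x∣<∣p∣ x∈p-x)

module _ (G : Graph) where

  ExternalPrivate : Subset (order G) → Rel (Vertex G) 0ℓ
  ExternalPrivate X x p = p ∉ X × Adj G p x × (∀ y → y ∈ X → Adj G p y → y ≡ x)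

  externalPrivate? : ∀ X x → Decidable (ExternalPrivate X x)
  externalPrivate? X x p = ¬? (p ∈? X) ×-dec adj? G p x ×-dec
    all? λ y → (y ∈? X) →-dec (adj? G p y →-dec (y ≟ x))

  -- In terms of neighbourhoods: N(x) - N[X - x] is nonempty for every x in X.
  OpenIrredundant : Subset (order G) → Set
  OpenIrredundant X = ∀ {x} → x ∈ X → ∃ (ExternalPrivate X x)

  Isolated : Subset (order G) → Pred (Vertex G) 0ℓ
  Isolated X v = v ∈ X × (∀ u → u ∈ X → ¬ Adj G v u)

  isolated? : ∀ X → Decidable (Isolated X)
  isolated? X v = (v ∈? X) ×-dec all? λ u → (u ∈? X) →-dec ¬? (adj? G v u)

  private
    isolated : Subset (order G) → Subset (order G)
    isolated X = toSubset (isolated? X)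

    -- The lexicographic order on size, then number of isolated vertices, packed into one number:
    -- the second entry is at most the order, so the factor `suc (order G)` lets the size decide.
    measure : Subset (order G) → ℕ
    measure X = ∣ X ∣ * suc (order G) + ∣ isolated X ∣

    -- A vertex without external private neighbour is either removed, or, if
    -- it is isolated in X, replaced by a neighbour, which is then not isolated.
    shrink : (∀ v → ∃[ u ] Adj G v u) → ∀ X → Acc _<_ (measure X) → Dominating G X →
             ∃[ Y ] Dominating G Y × OpenIrredundant Y
    shrink nbr X (acc rec) dom
      with any? (λ x → (x ∈? X) ×-dec ¬? (any? (externalPrivate? X x)))
    ... | no none = X , dom , λ {x} x∈X → decidable-stable (any? (externalPrivate? X x))
                                             (λ no-ext → none (x , x∈X , no-ext))
    ... | yes (x , x∈X , no-ext) = step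
      where
      -- Were `x` the only neighbour of `v` in `X`, then `v` would be an external private neighbour
      -- of `x`.
      elsewhere : ∀ {v} → v ∉ X → Adj G v x → ∃[ u ] u ∈ X × u ≢ x × Adj G v u
      elsewhere {v} v∉X v~x
        with any? (λ u → (u ∈? X) ×-dec ¬? (u ≟ x) ×-dec adj? G v u)
      ... | yes found = found
      ... | no none = contradiction
        (v , v∉X , v~x , λ y y∈X v~y →
          decidable-stable (y ≟ x) λ y≢x → none (y , y∈X , y≢x , v~y))
        no-ext

      others : ∀ v → v ≢ x → v ∈ X - x ⊎ ∃[ u ] u ∈ X - x × Adj G v u
      others v v≢x with v ∈? X
      ... | yes v∈X = inj₁ (x∈p∧x≢y⇒x∈p-y v∈X v≢x)
      ... | no v∉X with dom v
      ...   | inj₁ v∈X = contradiction v∈X v∉X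
      ...   | inj₂ (u , u∈X , v~u) with u ≟ x
      ...     | no u≢x = inj₂ (u , x∈p∧x≢y⇒x∈p-y u∈X u≢x , v~u)
      ...     | yes refl with elsewhere v∉X v~u
      ...       | w , w∈X , w≢x , v~w = inj₂ (w , x∈p∧x≢y⇒x∈p-y w∈X w≢x , v~w)

      size : ∣ X - x ∣ < ∣ X ∣
      size = x∈p⇒∣p-x∣<∣p∣ x∈X

      step : ∃[ Y ] Dominating G Y × OpenIrredundant Y
      step with any? (λ y → (y ∈? X) ×-dec adj? G x y)
      ... | yes (y , y∈X , x~y) = shrink nbr (X - x) (rec smaller) dom′
        where
        smaller : measure (X - x) < measure X
        smaller = begin-strict
          ∣ X - x ∣ * suc (order G) + ∣ isolated (X - x) ∣
            <⟨ +-monoʳ-< (∣ X - x ∣ * suc (order G)) (s≤s (∣p∣≤n (isolated (X - x)))) ⟩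
          ∣ X - x ∣ * suc (order G) + suc (order G)
            ≡⟨ +-comm (∣ X - x ∣ * suc (order G)) (suc (order G)) ⟩
          suc ∣ X - x ∣ * suc (order G)
            ≤⟨ *-monoˡ-≤ (suc (order G)) size ⟩
          ∣ X ∣ * suc (order G)
            ≤⟨ m≤m+n _ _ ⟩
          measure X ∎
          where open ≤-Reasoning

        dom′ : Dominating G (X - x)
        dom′ v with v ≟ x
        ... | no v≢x  = others v v≢x
        ... | yes refl = inj₂ (y , x∈p∧x≢y⇒x∈p-y y∈X (λ { refl → adj-irrefl G refl x~y }) , x~y)

      ... | no x-isolated = shrink nbr X′ (rec smaller) dom′
        where
        y = proj₁ (nbr x)
        x~y = proj₂ (nbr x)

        X′ = (X - x) ∪ ⁅ y ⁆

        X-x⊆X′ : X - x ⊆ X′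
        X-x⊆X′ = p⊆p∪q ⁅ y ⁆

        y∈X′ : y ∈ X′
        y∈X′ = q⊆p∪q (X - x) ⁅ y ⁆ (x∈⁅x⁆ y)

        dom′ : Dominating G X′
        dom′ v with v ≟ x
        ... | no v≢x   = Sum.map X-x⊆X′ (λ (u , u∈ , v~u) → u , X-x⊆X′ u∈ , v~u) (others v v≢x)
        ... | yes refl = inj₂ (y , y∈X′ , x~y)

        isolated-⊆ : ∀ {v} → Isolated X′ v → Isolated X v
        isolated-⊆ {v} (v∈X′ , alone) with x∈p∪q⁻ (X - x) ⁅ y ⁆ v∈X′
        -- Deleting `x` isolates no further vertex, because `x` has no neighbour in `X`.
        ... | inj₁ v∈X-x = v∈X , λ u u∈X v~u → case-u u u∈X v~u
          where
          v∈X = p─q⊆p X ⁅ x ⁆ v∈X-x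
          case-u : ∀ u → u ∈ X → ¬ Adj G v u
          case-u u u∈X v~u with u ≟ x
          ... | yes refl = x-isolated (v , v∈X , adj-sym G v~u)
          ... | no u≢x   = alone u (X-x⊆X′ (x∈p∧x≢y⇒x∈p-y u∈X u≢x)) v~u
        -- The new vertex `y` is not isolated: it lies outside `X`, as `x` is isolated there, so it
        -- has a second neighbour in `X`.
        ... | inj₂ v∈⁅y⁆ with x∈⁅y⁆⇒x≡y y v∈⁅y⁆
        ...   | refl with elsewhere (λ y∈X → x-isolated (y , y∈X , x~y)) (adj-sym G x~y)
        ...     | u , u∈X , u≢x , y~u =
          contradiction y~u (alone u (X-x⊆X′ (x∈p∧x≢y⇒x∈p-y u∈X u≢x)))

        x∉isolated : x ∉ isolated X′
        x∉isolated x∈ with x∈p∪q⁻ (X - x) ⁅ y ⁆ (proj₁ (∈-toSubset⁻ (isolated? X′) x∈))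
        ... | inj₁ x∈X-x = x∉p-x X x x∈X-x
        ... | inj₂ x∈⁅y⁆ = adj-irrefl G (x∈⁅y⁆⇒x≡y y x∈⁅y⁆) x~y

        fewer-isolated : ∣ isolated X′ ∣ < ∣ isolated X ∣
        fewer-isolated = p⊂q⇒∣p∣<∣q∣
          ( ∈-toSubset⁺ (isolated? X) ∘ isolated-⊆ ∘ ∈-toSubset⁻ (isolated? X′)
          , x
          , ∈-toSubset⁺ (isolated? X) (x∈X , λ u u∈X x~u → x-isolated (u , u∈X , x~u))
          , x∉isolated )

        size′ : ∣ X′ ∣ ≤ ∣ X ∣
        size′ = begin
          ∣ X′ ∣                  ≤⟨ ∣p∪q∣≤∣p∣+∣q∣ (X - x) ⁅ y ⁆ ⟩
          ∣ X - x ∣ + ∣ ⁅ y ⁆ ∣   ≡⟨ cong (∣ X - x ∣ +_) (∣⁅x⁆∣≡1 y) ⟩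
          ∣ X - x ∣ + 1           ≡⟨ +-comm ∣ X - x ∣ 1 ⟩
          suc ∣ X - x ∣           ≤⟨ size ⟩
          ∣ X ∣                   ∎
          where open ≤-Reasoning

        smaller : measure X′ < measure X
        smaller = +-mono-≤-< (*-monoˡ-≤ (suc (order G)) size′) fewer-isolated

  -- Bollobás and Cockayne.
  openIrredundantDominating : (∀ v → ∃[ u ] Adj G v u) →
                              ∃[ X ] Dominating G X × OpenIrredundant X
  openIrredundantDominating nbr = shrink nbr ⊤ (<-wellFounded _) (λ _ → inj₁ ∈⊤)

-- Cylinders and a factor without leaves.

TriangleFree : Graph → Set
TriangleFree G = ∀ {u v w} → Adj G u v → Adj G v w → ¬ Adj G w u

-- Only degree one is excluded; an isolated vertex satisfies the condition vacuously.
Leafless : Graph → Set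
Leafless G = ∀ {v u} → Adj G v u → ∃[ w ] Adj G v w × w ≢ u

module _ (G H : Graph) {X : Subset (order G)} (dom : Dominating G X) where

  cylinder-dominates : Dominates (□-Adj G H) ((_∈ X) ∘ proj₁)
  cylinder-dominates (g , h) with dom g
  ... | inj₁ g∈X = (g , h) , g∈X , refl
  ... | inj₂ (u , u∈X , g~u) = (u , h) , u∈X , [ inj₂ (refl , g~u) ]

  -- Dominating sets of the two factors are compared as cylinders in one product, so one of the two
  -- must sit over the second coordinate.
  cylinder-dominates′ : Dominates (□-Adj H G) ((_∈ X) ∘ proj₂)
  cylinder-dominates′ (h , g) with dom g
  ... | inj₁ g∈X = (h , g) , g∈X , refl
  ... | inj₂ (u , u∈X , g~u) = (h , u) , u∈X , [ inj₁ (refl , g~u) ]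

  -- If `p` is an external private neighbour of `x`, then `(p , h)` is private to `(x , h)`: moving
  -- along H keeps the first coordinate `p`, which lies outside `X`.
  cylinder-irredundant : OpenIrredundant G X →
                         Irredundant (□-Adj G H) ((_∈ X) ∘ proj₁)
  cylinder-irredundant irr {x , h} x∈X with irr x∈X
  ... | p , p∉X , p~x , only-x = (p , h) , [ inj₂ (refl , p~x) ] , λ where
    w∈X refl → contradiction w∈X p∉X
    w∈X [ inj₁ (refl , _) ]   → contradiction w∈X p∉X
    w∈X [ inj₂ (refl , p~w) ] → cong (_, h) (only-x _ w∈X p~w)

module _ (G : Graph) where

  closedNbr? : ∀ v → Decidable (λ u → v ≡ u ⊎ Adj G v u)
  closedNbr? v u = (v ≟ u) ⊎-dec adj? G v u

  -- Equals deg v + 1, since no vertex is adjacent to itself.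
  closedDegree : Vertex G → ℕ
  closedDegree v = count (closedNbr? v)

∑₂-distrib-+ : (f g : Fin m → Fin n → ℕ) →
  ∑[ i < m ] ∑[ j < n ] (f i j + g i j) ≡
  ∑[ i < m ] ∑[ j < n ] f i j + ∑[ i < m ] ∑[ j < n ] g i j
∑₂-distrib-+ {m} {n} f g = trans (sum-cong-≗ λ i → ∑-distrib-+ (f i) (g i))
  (∑-distrib-+ (λ i → ∑[ j < n ] f i j) (λ i → ∑[ j < n ] g i j))

module _ (G H : Graph) (wd : WellDominatedPairs G H)
         (triangle-free : TriangleFree H) (leafless : Leafless H)
         {X : Subset (order G)} (dom : Dominating G X) (irr : OpenIrredundant G X) where

  -- In X × V(H), trade {x} × N[h] for the external private neighbours of x
  -- in the layer of h.
  closedDegree≤externalPrivates : ∀ {x} → x ∈ X → ∀ h →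
    closedDegree H h ≤ count (externalPrivate? G X x)
  closedDegree≤externalPrivates {x} x∈X h = begin
    closedDegree H h
      ≤⟨ ∑-mono (λ j → ⟦⟧-mono (closedNbr? H h j) (removed? (x , j)) (refl ,_)) ⟩
    ∑[ j < order H ] ⟦ removed? (x , j) ⟧
      ≤⟨ term≤∑ (λ g → ∑[ j < order H ] ⟦ removed? (g , j) ⟧) x ⟩
    count₂ removed?
      ≤⟨ +-cancelʳ-≤ (count₂ traded?) _ _ balance ⟩
    count₂ added?
      ≤⟨ ∑-mono (λ g → count-at h (externalPrivate? G X x g)) ⟩
    count (externalPrivate? G X x)
      ∎
    where
    open ≤-Reasoning

    Removed Added Traded : Pred (Vertex G × Vertex H) 0ℓ
    Removed (g , j) = g ≡ x × (h ≡ j ⊎ Adj H h j)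
    Added   (g , j) = j ≡ h × ExternalPrivate G X x g
    Traded  (g , j) = g ∈ X × ¬ Removed (g , j) ⊎ Added (g , j)

    removed? : Decidable Removed
    removed? (g , j) = (g ≟ x) ×-dec closedNbr? H h j

    added? : Decidable Added
    added? (g , j) = (j ≟ h) ×-dec externalPrivate? G X x g

    traded? : Decidable Traded
    traded? p@(g , j) = ((g ∈? X) ×-dec ¬? (removed? p)) ⊎-dec added? p

    cylinder? : Decidable {A = Vertex G × Vertex H} ((_∈ X) ∘ proj₁)
    cylinder? (g , j) = g ∈? X

    -- The bookkeeping stays additive: removed and traded pairs are disjoint, and both lie in the
    -- union of the cylinder and the added pairs.
    pointwise : ∀ p → ⟦ removed? p ⟧ + ⟦ traded? p ⟧ ≤ ⟦ cylinder? p ⟧ + ⟦ added? p ⟧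
    pointwise p@(g , j) = ≤-trans
      (⟦⟧-disjoint (removed? p) (traded? p) (removed? p ⊎-dec traded? p) inj₁ inj₂
        λ { r (inj₁ (_ , ¬r)) → ¬r r
          ; (refl , _) (inj₂ (_ , x∉X , _)) → x∉X x∈X })
      (⟦⟧-cover (cylinder? p) (added? p) (removed? p ⊎-dec traded? p)
        λ { (inj₁ (refl , _)) → inj₁ x∈X
          ; (inj₂ (inj₁ (g∈X , _))) → inj₁ g∈X
          ; (inj₂ (inj₂ a)) → inj₂ a })

    traded-dominates : Dominates (□-Adj G H) Traded
    traded-dominates (g , j) with closedNbr? H h j
    ... | no far with dom g
    ...   | inj₁ g∈X = (g , j) , inj₁ (g∈X , far ∘ proj₂) , refl
    ...   | inj₂ (u , u∈X , g~u) =
      (u , j) , inj₁ (u∈X , far ∘ proj₂) , [ inj₂ (refl , g~u) ]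
    traded-dominates (g , j) | yes near with g ∈? X
    ... | yes g∈X with g ≟ x
    ...   | no g≢x = (g , j) , inj₁ (g∈X , g≢x ∘ proj₁) , refl
    ...   | yes refl with near
    ...     | inj₁ refl =
      let p , external = irr x∈X
      in  (p , h) , inj₂ (refl , external) , [ inj₂ (refl , adj-sym G (proj₁ (proj₂ external))) ]
    -- Leaflessness gives `j` a neighbour `w` other than `h`, and triangle-freeness keeps `w` out of
    -- N[h], so `(x , w)` was not removed.
    ...     | inj₂ h~j =
      let w , j~w , w≢h = leafless (adj-sym H h~j)
      in  (x , w) ,
          inj₁ (x∈X , λ { (_ , inj₁ h≡w) → w≢h (sym h≡w)
                        ; (_ , inj₂ h~w) → triangle-free h~j j~w (adj-sym H h~w) }) ,
          [ inj₁ (refl , j~w) ]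
    traded-dominates (g , j) | yes near | no g∉X
      with any? (λ y → (y ∈? X) ×-dec ¬? (y ≟ x) ×-dec adj? G g y)
    ... | yes (y , y∈X , y≢x , g~y) =
      (y , j) , inj₁ (y∈X , y≢x ∘ proj₁) , [ inj₂ (refl , g~y) ]
    -- With `x` as its only neighbour in `X`, `g` is an external private neighbour, so `(g , h)` was
    -- added; it dominates `(g , j)` because `j` lies in N[h].
    ... | no none = (g , h) , inj₂ (refl , g∉X , g~x , only-x) , to-layer near
      where
      only-x : ∀ y → y ∈ X → Adj G g y → y ≡ x
      only-x y y∈X g~y = decidable-stable (y ≟ x) λ y≢x → none (y , y∈X , y≢x , g~y)

      g~x : Adj G g x
      g~x with dom g
      ... | inj₁ g∈X = contradiction g∈X g∉X
      ... | inj₂ (u , u∈X , g~u) = subst (Adj G g) (only-x u u∈X g~u) g~u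

      to-layer : h ≡ j ⊎ Adj H h j → ReflClosure (□-Adj G H) (g , j) (g , h)
      to-layer (inj₁ refl) = refl
      to-layer (inj₂ h~j)  = [ inj₁ (refl , adj-sym H h~j) ]

    balance : count₂ removed? + count₂ traded? ≤ count₂ added? + count₂ traded?
    balance = begin
      count₂ removed? + count₂ traded?
        ≡⟨ ∑₂-distrib-+ (λ g j → ⟦ removed? (g , j) ⟧) (λ g j → ⟦ traded? (g , j) ⟧) ⟨
      ∑[ g < order G ] ∑[ j < order H ] (⟦ removed? (g , j) ⟧ + ⟦ traded? (g , j) ⟧)
        ≤⟨ ∑-mono (λ g → ∑-mono λ j → pointwise (g , j)) ⟩
      ∑[ g < order G ] ∑[ j < order H ] (⟦ cylinder? (g , j) ⟧ + ⟦ added? (g , j) ⟧)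
        ≡⟨ ∑₂-distrib-+ (λ g j → ⟦ cylinder? (g , j) ⟧) (λ g j → ⟦ added? (g , j) ⟧) ⟩
      count₂ cylinder? + count₂ added?
        ≤⟨ +-monoˡ-≤ (count₂ added?) (wd cylinder? traded? (cylinder-dominates G H dom)
             (cylinder-irredundant G H dom irr) traded-dominates) ⟩
      count₂ traded? + count₂ added?
        ≡⟨ +-comm (count₂ traded?) (count₂ added?) ⟩
      count₂ added? + count₂ traded?
        ∎

-- Packing in one factor and covering in the other.

-- Each `x` in `X` together with its external private neighbours forms a star of at least `suc k`
-- vertices, and these stars are pairwise disjoint.
packing : ∀ G {X} → OpenIrredundant G X → ∀ k →
          (∀ {x} → x ∈ X → k ≤ count (externalPrivate? G X x)) →
          ∣ X ∣ * suc k ≤ order G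
packing G {X} irr k k≤ = begin
  ∣ X ∣ * suc k
    ≡⟨ cong (_* suc k) (∣∣≡count X) ⟩
  count (_∈? X) * suc k
    ≡⟨ *-distribʳ-sum (suc k) (⟦_⟧ ∘ (_∈? X)) ⟩
  ∑[ x < order G ] (⟦ x ∈? X ⟧ * suc k)
    ≤⟨ ∑-mono (λ x → guarded-≥ (x ∈? X) (star? x) star-size) ⟩
  ∑[ x < order G ] ∑[ g < order G ] ⟦ (x ∈? X) ×-dec star? x g ⟧
    ≡⟨ ∑-comm (λ x g → ⟦ (x ∈? X) ×-dec star? x g ⟧) ⟩
  ∑[ g < order G ] ∑[ x < order G ] ⟦ (x ∈? X) ×-dec star? x g ⟧
    ≤⟨ ∑-mono (λ g → count-unique (λ x → (x ∈? X) ×-dec star? x g) (disjoint g)) ⟩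
  ∑[ g < order G ] 1
    ≡⟨ ∑-const (order G) 1 ⟩
  order G * 1
    ≡⟨ *-identityʳ (order G) ⟩
  order G ∎
  where
  open ≤-Reasoning

  star? : ∀ x → Decidable (λ g → g ≡ x ⊎ ExternalPrivate G X x g)
  star? x g = (g ≟ x) ⊎-dec externalPrivate? G X x g

  star-size : ∀ {x} → x ∈ X → suc k ≤ count (star? x)
  star-size {x} x∈X = begin
    suc k
      ≤⟨ +-mono-≤ (count-≥1 (_≟ x) (x , refl)) (k≤ x∈X) ⟩
    count (_≟ x) + count (externalPrivate? G X x)
      ≡⟨ ∑-distrib-+ (⟦_⟧ ∘ (_≟ x)) (⟦_⟧ ∘ externalPrivate? G X x) ⟨
    ∑[ g < order G ] (⟦ g ≟ x ⟧ + ⟦ externalPrivate? G X x g ⟧)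
      ≤⟨ ∑-mono (λ g → ⟦⟧-disjoint (g ≟ x) (externalPrivate? G X x g) (star? x g)
           inj₁ inj₂ λ { refl (x∉X , _) → x∉X x∈X }) ⟩
    count (star? x) ∎

  disjoint : ∀ g {x y} → x ∈ X × (g ≡ x ⊎ ExternalPrivate G X x g) →
             y ∈ X × (g ≡ y ⊎ ExternalPrivate G X y g) → x ≡ y
  disjoint g (_ , inj₁ refl) (_ , inj₁ refl) = refl
  disjoint g (x∈X , inj₁ refl) (_ , inj₂ (x∉X , _)) = contradiction x∈X x∉X
  disjoint g (_ , inj₂ (y∉X , _)) (y∈X , inj₁ refl) = contradiction y∈X y∉X
  disjoint g (x∈X , inj₂ (_ , g~x , _)) (_ , inj₂ (_ , _ , only-y)) = only-y _ x∈X g~x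

-- The closed neighbourhoods of the vertices of `D` cover the graph; the incidences are counted from
-- both sides.
covering : ∀ H {D} → Dominating H D →
           order H ≤ ∑[ d < order H ] (⟦ d ∈? D ⟧ * closedDegree H d)
covering H {D} dom = begin
  order H
    ≡⟨ trans (∑-const (order H) 1) (*-identityʳ (order H)) ⟨
  ∑[ j < order H ] 1
    ≤⟨ ∑-mono (λ j → count-≥1 (λ d → (d ∈? D) ×-dec closedNbr? H d j) (dominator j)) ⟩
  ∑[ j < order H ] ∑[ d < order H ] ⟦ (d ∈? D) ×-dec closedNbr? H d j ⟧
    ≡⟨ ∑-comm (λ j d → ⟦ (d ∈? D) ×-dec closedNbr? H d j ⟧) ⟩
  ∑[ d < order H ] ∑[ j < order H ] ⟦ (d ∈? D) ×-dec closedNbr? H d j ⟧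
    ≤⟨ ∑-mono (λ d → guarded-≤ (d ∈? D) (closedNbr? H d)) ⟩
  ∑[ d < order H ] (⟦ d ∈? D ⟧ * closedDegree H d) ∎
  where
  open ≤-Reasoning

  dominator : ∀ j → ∃[ d ] d ∈ D × (d ≡ j ⊎ Adj H d j)
  dominator j with dom j
  ... | inj₁ j∈D             = j , j∈D , inj₁ refl
  ... | inj₂ (d , d∈D , j~d) = d , d∈D , inj₂ (adj-sym H j~d)

dominating-nonempty : ∀ G {D} → Vertex G → Dominating G D → 1 ≤ ∣ D ∣
dominating-nonempty G {D} v dom =
  ≤-trans (count-≥1 (_∈? D) member) (≤-reflexive (sym (∣∣≡count D)))
  where
  member : ∃ (_∈ D)
  member with dom v
  ... | inj₁ v∈D           = v , v∈D
  ... | inj₂ (u , u∈D , _) = u , u∈D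

leafless-impossible : ∀ G H → WellDominatedPairs G H →
  TriangleFree H → Leafless H → Vertex G → Vertex H →
  (∀ v → ∃[ u ] Adj G v u) → (∀ v → ∃[ u ] Adj H v u) → ⊥
leafless-impossible G H wd triangle-free leafless g₀ h₀ nbrG nbrH
  with openIrredundantDominating G nbrG | openIrredundantDominating H nbrH
... | X , domX , irrX | D , domD , irrD =
  -- Cancelling the positive factor `∣ X ∣` leaves `order H + ∣ D ∣ ≤ order H`, against `1 ≤ ∣ D ∣`.
  <⇒≱ (m<m+n (order H) ∣D∣≥1) (*-cancelˡ-≤ ∣ X ∣ {{>-nonZero ∣X∣≥1}} (≤-trans lower upper))
  where
  open ≤-Reasoning

  ∣X∣≥1 = dominating-nonempty G g₀ domX
  ∣D∣≥1 = dominating-nonempty H h₀ domD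

  upper : ∣ D ∣ * order G ≤ ∣ X ∣ * order H
  upper = begin
    ∣ D ∣ * order G
      ≡⟨ cong (_* order G) (∣∣≡count D) ⟩
    count (_∈? D) * order G
      ≡⟨ *-distribʳ-sum (order G) (⟦_⟧ ∘ (_∈? D)) ⟩
    ∑[ h < order H ] (⟦ h ∈? D ⟧ * order G)
      ≡⟨ sum-cong-≗ (λ h → trans (*-comm ⟦ h ∈? D ⟧ (order G))
                                 (sym (∑-const (order G) ⟦ h ∈? D ⟧))) ⟩
    ∑[ h < order H ] ∑[ g < order G ] ⟦ h ∈? D ⟧
      -- In H □ G the minimal set `D` × V(G) is compared with the dominating set V(H) × `X`.
      ≤⟨ wellDominatedPairs-swap G H wd ((_∈? D) ∘ proj₁) ((_∈? X) ∘ proj₂)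
           (cylinder-dominates H G domD) (cylinder-irredundant H G domD irrD)
           (cylinder-dominates′ G H domX) ⟩
    ∑[ h < order H ] count (_∈? X)
      ≡⟨ ∑-const (order H) (count (_∈? X)) ⟩
    order H * count (_∈? X)
      ≡⟨ cong (order H *_) (∣∣≡count X) ⟨
    order H * ∣ X ∣
      ≡⟨ *-comm (order H) ∣ X ∣ ⟩
    ∣ X ∣ * order H ∎

  -- The indicator makes vertices outside `D` contribute zero, so the packing bounds can be summed
  -- over all of V(H).
  stars : ∀ d → ∣ X ∣ * (⟦ d ∈? D ⟧ * suc (closedDegree H d)) ≤ ⟦ d ∈? D ⟧ * order G
  stars d = begin
    ∣ X ∣ * (⟦ d ∈? D ⟧ * suc (closedDegree H d))
      ≡⟨ x∙yz≈y∙xz ∣ X ∣ ⟦ d ∈? D ⟧ (suc (closedDegree H d)) ⟩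
    ⟦ d ∈? D ⟧ * (∣ X ∣ * suc (closedDegree H d))
      ≤⟨ *-monoʳ-≤ ⟦ d ∈? D ⟧ (packing G irrX (closedDegree H d) λ x∈X →
           closedDegree≤externalPrivates G H wd triangle-free leafless domX irrX x∈X d) ⟩
    ⟦ d ∈? D ⟧ * order G ∎

  -- The centre of each star adds one to the closed degree, which summed over `D` gives the extra
  -- `∣ D ∣`.
  lower : ∣ X ∣ * (order H + ∣ D ∣) ≤ ∣ D ∣ * order G
  lower = begin
    ∣ X ∣ * (order H + ∣ D ∣)
      ≡⟨ cong (∣ X ∣ *_) (trans (+-comm (order H) ∣ D ∣) (cong (_+ order H) (∣∣≡count D))) ⟩
    ∣ X ∣ * (count (_∈? D) + order H)
      ≤⟨ *-monoʳ-≤ ∣ X ∣ (+-monoʳ-≤ (count (_∈? D)) (covering H domD)) ⟩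
    ∣ X ∣ * (count (_∈? D) + ∑[ d < order H ] (⟦ d ∈? D ⟧ * closedDegree H d))
      ≡⟨ cong (∣ X ∣ *_) (∑-distrib-+ (⟦_⟧ ∘ (_∈? D)) (λ d → ⟦ d ∈? D ⟧ * closedDegree H d)) ⟨
    ∣ X ∣ * ∑[ d < order H ] (⟦ d ∈? D ⟧ + ⟦ d ∈? D ⟧ * closedDegree H d)
      ≡⟨ cong (∣ X ∣ *_) (sum-cong-≗ λ d → *-suc ⟦ d ∈? D ⟧ (closedDegree H d)) ⟨
    ∣ X ∣ * ∑[ d < order H ] (⟦ d ∈? D ⟧ * suc (closedDegree H d))
      ≡⟨ *-distribˡ-sum ∣ X ∣ (λ d → ⟦ d ∈? D ⟧ * suc (closedDegree H d)) ⟩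
    ∑[ d < order H ] (∣ X ∣ * (⟦ d ∈? D ⟧ * suc (closedDegree H d)))
      ≤⟨ ∑-mono stars ⟩
    ∑[ d < order H ] (⟦ d ∈? D ⟧ * order G)
      ≡⟨ *-distribʳ-sum (order G) (⟦_⟧ ∘ (_∈? D)) ⟨
    count (_∈? D) * order G
      ≡⟨ cong (_* order G) (∣∣≡count D) ⟨
    ∣ D ∣ * order G ∎

-- Leaves in both factors.

-- `ℓ` has degree one and `s` is its support vertex.
Leaf : (G : Graph) → Rel (Vertex G) 0ℓ
Leaf G ℓ s = Adj G ℓ s × (∀ u → Adj G ℓ u → u ≡ s)

leaf-or-leafless : ∀ G → (∃[ ℓ ] ∃[ s ] Leaf G ℓ s) ⊎ Leafless G
leaf-or-leafless G
  with any? (λ ℓ → any? λ s → adj? G ℓ s ×-dec all? λ u → adj? G ℓ u →-dec (u ≟ s))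
... | yes leaf = inj₁ leaf
... | no none  = inj₂ another
  where
  another : Leafless G
  another {v} {u} v~u with any? (λ w → adj? G v w ×-dec ¬? (w ≟ u))
  ... | yes found = found
  ... | no only = contradiction
    (v , u , v~u , λ w v~w → decidable-stable (w ≟ u) λ w≢u → only (w , v~w , w≢u)) none

module _ (G H : Graph) (wd : WellDominated (G □ H))
         (triangle-free-G : TriangleFree G) (triangle-free-H : TriangleFree H)
         {ℓ s m t} (leaf-G : Leaf G ℓ s) (leaf-H : Leaf H m t) where

  private
    ℓ~s = proj₁ leaf-G
    m~t = proj₁ leaf-H

    -- Neighbours reached along the same factor are separated by triangle-freeness; those reached
    -- along different factors differ in both coordinates.
    independent : ∀ {u v} → □-Adj G H (s , t) u → □-Adj G H (s , t) v → ¬ □-Adj G H u v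
    independent (inj₁ (refl , t~h)) (inj₁ (refl , t~k)) (inj₁ (_ , h~k)) =
      triangle-free-H t~h h~k (adj-sym H t~k)
    independent (inj₁ (refl , _)) (inj₁ (refl , _)) (inj₂ (_ , s~s)) = adj-irrefl G refl s~s
    independent (inj₁ (refl , _)) (inj₂ (refl , s~g)) (inj₁ (s≡g , _)) = adj-irrefl G s≡g s~g
    independent (inj₁ (refl , t~h)) (inj₂ (refl , _)) (inj₂ (h≡t , _)) = adj-irrefl H (sym h≡t) t~h
    independent (inj₂ (refl , s~g)) (inj₁ (refl , _)) (inj₁ (g≡s , _)) = adj-irrefl G (sym g≡s) s~g
    independent (inj₂ (refl , _)) (inj₁ (refl , t~h)) (inj₂ (t≡h , _)) = adj-irrefl H t≡h t~h
    independent (inj₂ (refl , _)) (inj₂ (refl , _)) (inj₁ (_ , t~t)) = adj-irrefl H refl t~t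
    independent (inj₂ (refl , s~g)) (inj₂ (refl , s~k)) (inj₂ (_ , g~k)) =
      triangle-free-G s~g g~k (adj-sym G s~k)

    Covered : Pred (Vertex G × Vertex H) 0ℓ
    Covered v = ReflClosure (□-Adj G H) v (ℓ , m) ⊎
      ∃[ j ] □-Adj G H (s , t) j × j ≢ (ℓ , t) × j ≢ (s , m) × ReflClosure (□-Adj G H) v j

    -- Otherwise (ℓ , t) and (s , m) are traded for (ℓ , m), while a third
    -- neighbour of (s , t) still dominates (s , t).
    no-third : ¬ (∃[ j ] □-Adj G H (s , t) j × j ≢ (ℓ , t) × j ≢ (s , m))
    no-third (j , st~j , j≢ℓt , j≢sm) = neighbourhood-trade-pairs G H wd
      (inj₂ (refl , adj-sym G ℓ~s)) (inj₁ (refl , adj-sym H m~t))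
      (λ eq → adj-irrefl G (cong proj₁ eq) ℓ~s)
      independent Sum.[ near-ℓt , near-sm ]
      where
      near-ℓt : ∀ {v} → ReflClosure (□-Adj G H) v (ℓ , t) → Covered v
      near-ℓt refl = inj₁ [ inj₁ (refl , adj-sym H m~t) ]
      near-ℓt {_ , h} [ inj₁ (refl , h~t) ] with h ≟ m
      ... | yes refl = inj₁ refl
      -- `(s , h)` is another neighbour of `(s , t)`, so it survives the trade, and it dominates
      -- `(ℓ , h)`.
      ... | no h≢m   = inj₂ ((s , h) , inj₁ (refl , adj-sym H h~t) ,
        (λ eq → adj-irrefl G (sym (cong proj₁ eq)) ℓ~s) , h≢m ∘ cong proj₂ ,
        [ inj₂ (refl , ℓ~s) ])
      -- `s` is the only neighbour of `ℓ`, so the vertex is `(s , t)` and the third neighbour `j`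
      -- dominates it.
      near-ℓt {g , _} [ inj₂ (refl , g~ℓ) ] with proj₂ leaf-G g (adj-sym G g~ℓ)
      ... | refl = inj₂ (j , st~j , j≢ℓt , j≢sm , [ st~j ])

      near-sm : ∀ {v} → ReflClosure (□-Adj G H) v (s , m) → Covered v
      near-sm refl = inj₁ [ inj₂ (refl , adj-sym G ℓ~s) ]
      near-sm {_ , h} [ inj₁ (refl , h~m) ] with proj₂ leaf-H h (adj-sym H h~m)
      ... | refl = inj₂ (j , st~j , j≢ℓt , j≢sm , [ st~j ])
      near-sm {g , _} [ inj₂ (refl , g~s) ] with g ≟ ℓ
      ... | yes refl = inj₁ refl
      ... | no g≢ℓ   = inj₂ ((g , t) , inj₂ (refl , adj-sym G g~s) ,
        g≢ℓ ∘ cong proj₁ , (λ eq → adj-irrefl H (sym (cong proj₂ eq)) m~t) ,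
        [ inj₁ (refl , m~t) ])

  -- A second neighbour `u` of `s` would give `(s , t)` the third neighbour `(u , t)`.
  support-is-leaf-G : Leaf G s ℓ
  support-is-leaf-G = adj-sym G ℓ~s , λ u s~u → decidable-stable (u ≟ ℓ) λ u≢ℓ →
    no-third ((u , t) , inj₂ (refl , s~u) , u≢ℓ ∘ cong proj₁ ,
           λ eq → adj-irrefl H (sym (cong proj₂ eq)) m~t)

  support-is-leaf-H : Leaf H t m
  support-is-leaf-H = adj-sym H m~t , λ u t~u → decidable-stable (u ≟ m) λ u≢m →
    no-third ((s , u) , inj₁ (refl , t~u) ,
           (λ eq → adj-irrefl G (sym (cong proj₁ eq)) ℓ~s) , u≢m ∘ cong proj₂)

-- Recognising K₂.

module _ (G : Graph) (connected : Connected G)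
         {ℓ s} (leaf-ℓ : Leaf G ℓ s) (leaf-s : Leaf G s ℓ) where

  private
    ends : ∀ v → v ≡ ℓ ⊎ v ≡ s
    ends v = reach (inj₁ refl) (connected ℓ v)
      where
      -- Each of `ℓ` and `s` has only the other as neighbour, so a walk never leaves the pair.
      reach : ∀ {u} → u ≡ ℓ ⊎ u ≡ s → Star (Adj G) u v → v ≡ ℓ ⊎ v ≡ s
      reach end ε = end
      reach (inj₁ refl) (u~w ◅ path) = reach (inj₂ (proj₂ leaf-ℓ _ u~w)) path
      reach (inj₂ refl) (u~w ◅ path) = reach (inj₁ (proj₂ leaf-s _ u~w)) path

    to : Vertex G → Fin 2
    to v = if does (v ≟ ℓ) then zero else suc zero

    from : Fin 2 → Vertex G
    from zero    = ℓ
    from (suc _) = s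

    s≢ℓ : s ≢ ℓ
    s≢ℓ s≡ℓ = adj-irrefl G s≡ℓ (proj₁ leaf-s)

    to∘from : ∀ i → to (from i) ≡ i
    to∘from zero       = cong (if_then zero else suc zero) (dec-true (ℓ ≟ ℓ) refl)
    to∘from (suc zero) = cong (if_then zero else suc zero) (dec-false (s ≟ ℓ) s≢ℓ)

    from∘to : ∀ v → from (to v) ≡ v
    from∘to v with v ≟ ℓ
    ... | yes refl = refl
    ... | no v≢ℓ with ends v
    ...   | inj₁ v≡ℓ  = contradiction v≡ℓ v≢ℓ
    ...   | inj₂ refl = refl

  two-leaves⇒K₂ : G ≅ K 2
  two-leaves⇒K₂ = record
    { vertices = mk↔ₛ′ to from to∘from from∘to
    ; edges    = λ u v → mk⇔
        (λ u~v eq → adj-irrefl G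
          (trans (sym (from∘to u)) (trans (cong from eq) (from∘to v))) u~v)
        (adjacent (ends u) (ends v))
    }
    where
    adjacent : ∀ {u v} → u ≡ ℓ ⊎ u ≡ s → v ≡ ℓ ⊎ v ≡ s → to u ≢ to v → Adj G u v
    adjacent (inj₁ refl) (inj₁ refl) ≢ = contradiction refl ≢
    adjacent (inj₁ refl) (inj₂ refl) ≢ = proj₁ leaf-ℓ
    adjacent (inj₂ refl) (inj₁ refl) ≢ = proj₁ leaf-s
    adjacent (inj₂ refl) (inj₂ refl) ≢ = contradiction refl ≢

-- The product of two copies of K₂.

≅K⇒order : ∀ {G n} → G ≅ K n → order G ≡ n
≅K⇒order iso = ↔⇒≡ (_≅_.vertices iso)

≅K⇒complete : ∀ {G n} → G ≅ K n → ∀ u v → Adj G u v ⇔ u ≢ v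
≅K⇒complete {G} iso u v = mk⇔
  (λ u~v u≡v → adj-irrefl G u≡v u~v)
  (λ u≢v → Equivalence.from (edges u v) (u≢v ∘ Injection.injective (↔⇒↣ vertices)))
  where open _≅_ iso

-- The product is the 4-cycle, and a decided search through its 16 vertex sets shows that the
-- minimal dominating ones have size 2.
wellDominated-K₂□K₂ : WellDominated (K 2 □ K 2)
wellDominated-K₂□K₂ D D′ min min′ = trans (size D min) (sym (size D′ min′))
  where
  Q = K 2 □ K 2

  -- Minimality implies this condition, which tests one-vertex deletions instead of all proper
  -- subsets and so keeps the search small.
  irreducible? : Decidable (λ D → Dominating Q D × (∀ x → x ∈ D → ¬ Dominating Q (D - x)))
  irreducible? D = dominating? Q D ×-dec
    all? λ x → (x ∈? D) →-dec ¬? (dominating? Q (D - x))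

  size : ∀ D → MinimalDominating Q D → ∣ D ∣ ≡ 2
  size D (dom , minimal) = decidable-stable (∣ D ∣ ≟ℕ 2) λ ∣D∣≢2 →
    from-no (anySubset? λ D → irreducible? D ×-dec ¬? (∣ D ∣ ≟ℕ 2))
      (D , (dom , λ x x∈D → minimal (D - x) (x∈p⇒p-x⊂p x∈D)) , ∣D∣≢2)

-- Matching both orders with 2 makes the vertex sets of `G □ H` and `K 2 □ K 2` literally equal, so
-- minimal dominating sets carry over unchanged.
wellDominated-complete₂ : ∀ G H → order G ≡ 2 → order H ≡ 2 →
  (∀ u v → Adj G u v ⇔ u ≢ v) → (∀ u v → Adj H u v ⇔ u ≢ v) → WellDominated (G □ H)
wellDominated-complete₂ G@record { order = .2 } H@record { order = .2 } refl refl
  completeG completeH D D′ min min′ =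
  wellDominated-K₂□K₂ D D′ (transfer min) (transfer min′)
  where
  adj⇒ : ∀ p q → □-Adj G H p q → □-Adj (K 2) (K 2) p q
  adj⇒ _ _ = Sum.map (λ (e , a) → e , Equivalence.to (completeH _ _) a)
                     (λ (e , a) → e , Equivalence.to (completeG _ _) a)

  adj⇐ : ∀ p q → □-Adj (K 2) (K 2) p q → □-Adj G H p q
  adj⇐ _ _ = Sum.map (λ (e , a) → e , Equivalence.from (completeH _ _) a)
                     (λ (e , a) → e , Equivalence.from (completeG _ _) a)

  transfer : ∀ {D} → MinimalDominating (G □ H) D → MinimalDominating (K 2 □ K 2) D
  transfer (dom , minimal) =
    (λ v → Sum.map₂ (λ (u , u∈D , a) → u , u∈D , adj⇒ (remQuot 2 v) (remQuot 2 u) a) (dom v)) ,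
    λ D′ D′⊂D dom′ → minimal D′ D′⊂D
      λ v → Sum.map₂ (λ (u , u∈D , a) → u , u∈D , adj⇐ (remQuot 2 v) (remQuot 2 u) a) (dom′ v)

-- Girth, connectivity and the case distinction on leaves.

girth≥4⇒triangleFree : ∀ {G} → GirthAtLeast 4 G → TriangleFree G
girth≥4⇒triangleFree {G} girth {u} {v} {w} u~v v~w w~u =
  -- A triangle is a cycle with `k = 0`, for which the girth bound reads 4 ≤ 3.
  contradiction (girth 0 triangle) (<⇒≱ ≤-refl)
  where
  corner : Fin 3 → Vertex G
  corner zero             = u
  corner (suc zero)       = v
  corner (suc (suc zero)) = w

  distinct : ∀ {i j} → corner i ≡ corner j → i ≡ j
  distinct {zero}             {zero}             _ = refl
  distinct {zero}             {suc zero}         e = contradiction u~v (adj-irrefl G e)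
  distinct {zero}             {suc (suc zero)}   e = contradiction w~u (adj-irrefl G (sym e))
  distinct {suc zero}         {zero}             e = contradiction u~v (adj-irrefl G (sym e))
  distinct {suc zero}         {suc zero}         _ = refl
  distinct {suc zero}         {suc (suc zero)}   e = contradiction v~w (adj-irrefl G e)
  distinct {suc (suc zero)}   {zero}             e = contradiction w~u (adj-irrefl G e)
  distinct {suc (suc zero)}   {suc zero}         e = contradiction v~w (adj-irrefl G (sym e))
  distinct {suc (suc zero)}   {suc (suc zero)}   _ = refl

  triangle : Cycle G 0
  triangle = record
    { vertex   = corner
    ; distinct = distinct
    ; step     = λ { zero → u~v ; (suc zero) → v~w }
    ; close    = w~u
    }

two-vertices : ∀ {n} → 2 ≤ n → (v : Fin n) → ∃[ u ] u ≢ v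
two-vertices (s≤s (s≤s _)) zero    = suc zero , λ ()
two-vertices (s≤s (s≤s _)) (suc _) = zero , λ ()

-- The first edge of a walk to a second vertex gives the neighbour.
no-isolated : ∀ G → Nontrivial G → Connected G → ∀ v → ∃[ u ] Adj G v u
no-isolated G nontrivial connected v with two-vertices nontrivial v
... | u , u≢v with connected v u
...   | ε       = contradiction refl u≢v
...   | v~w ◅ _ = _ , v~w

some-vertex : ∀ G → Nontrivial G → Vertex G
some-vertex G nontrivial = fromℕ< (<⇒≤ nontrivial)

theorem2 : (G H : Graph) →
    Nontrivial G → Connected G → GirthAtLeast 4 G →
    Nontrivial H → Connected H → GirthAtLeast 4 H →
    WellDominated (G □ H) ⇔ (G ≅ K 2 × H ≅ K 2)
theorem2 G H ntG conG girthG ntH conH girthH = mk⇔ ⇒ ⇐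
  where
  tfG = girth≥4⇒triangleFree girthG
  tfH = girth≥4⇒triangleFree girthH

  nbrG = no-isolated G ntG conG
  nbrH = no-isolated H ntH conH

  ⇒ : WellDominated (G □ H) → G ≅ K 2 × H ≅ K 2
  ⇒ wd with leaf-or-leafless G | leaf-or-leafless H
  ... | inj₁ (_ , _ , leafG) | inj₁ (_ , _ , leafH) =
    two-leaves⇒K₂ G conG leafG (support-is-leaf-G G H wd tfG tfH leafG leafH) ,
    two-leaves⇒K₂ H conH leafH (support-is-leaf-H G H wd tfG tfH leafG leafH)
  ... | _ | inj₂ leafless = ⊥-elim (leafless-impossible G H (wellDominatedPairs G H wd)
    tfH leafless (some-vertex G ntG) (some-vertex H ntH) nbrG nbrH)
  -- Swapping the factors reduces this to the case of a leafless second factor.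
  ... | inj₂ leafless | _ = ⊥-elim (leafless-impossible H G
    (wellDominatedPairs-swap G H (wellDominatedPairs G H wd))
    tfG leafless (some-vertex H ntH) (some-vertex G ntG) nbrH nbrG)

  ⇐ : G ≅ K 2 × H ≅ K 2 → WellDominated (G □ H)
  ⇐ (isoG , isoH) = wellDominated-complete₂ G H (≅K⇒order isoG) (≅K⇒order isoH)
    (≅K⇒complete isoG) (≅K⇒complete isoH)
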